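{- Let $G=(V_1\cup V_2,E)$ be a bipartite graph with bipartition $(V_1,V_2)$, with maximum degree $\Delta(G)$ and with no isolated vertices. Put $\Delta_{V_1}=\max\{d(u): u\in V_1\}$ and $\Delta_{V_2}=\max\{d(u): u\in V_2\}$. Then $$\chi'_{\mathrm{inj}}(G)\leq\begin{cases}\min\{\Delta_{V_1}(\Delta_{V_2}-1),\ \Delta_{V_2}(\Delta_{V_1}-1)\}+1 & \text{if } \Delta(G)\geq 3,\\ 3 & \text{if } \Delta(G)=2.\end{cases}$$
   Context: All graphs are finite and simple; $d(u)$ denotes the degree of $u$ in $G$. Three edges $e_1,e_2,e_3$ of a graph are consecutive if they form (in this order) a path of length three or a cycle of length three. An injective edge-coloring of $G$ with $k$ colors is a map $c:E(G)\to\{1,\dots,k\}$ (not necessarily a proper edge-coloring) such that $c(e_1)\neq c(e_3)$ whenever $e_1,e_2,e_3$ are consecutive edges in $G$. The injective chromatic index $\chi'_{\mathrm{inj}}(G)$ is the minimum $k$ such that $G$ has an injective edge-coloring with $k$ colors. -}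

module Defs where

open import Data.Fin using (Fin; finToFun; funToFin; _<?_)
open import Data.Fin.Properties using (_≟_; any?; all?; finToFun-funToFin)
open import Data.Fin.Subset using (Subset; _∈_)
open import Data.Fin.Subset.Properties using (_∈?_)
open import Data.List using (List; []; _∷_; length; map; filter; allFin; cartesianProduct; lookup)
open import Data.List.Extrema.Nat using (max)
open import Data.List.Relation.Unary.All using ([]; _∷_)
open import Data.List.Relation.Unary.AllPairs using ([]; _∷_)
open import Data.List.Relation.Unary.Unique.Propositional using (Unique)
import Data.List.Relation.Unary.Unique.DecPropositional as DecUnique
open import Data.Nat using (ℕ; zero; suc; _≤_; z≤n; s≤s)
open import Data.Product using (∃; ∃-syntax; _×_; _,_; proj₁; proj₂)
open import Data.Product.Properties using (≡-dec)
open import Data.Sum using (_⊎_; inj₁; inj₂; [_,_]′)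
open import Function using (id; _∘_)
open import Level using (0ℓ)
open import Relation.Binary using (Rel; Decidable; Symmetric; Irreflexive)
open import Relation.Binary.PropositionalEquality using (_≡_; _≢_; _≗_; refl; sym; trans)
open import Relation.Nullary using (¬_; Dec; yes; no; contradiction)
open import Relation.Nullary.Decidable using (map′; ¬?; _×-dec_; _⊎-dec_; _→-dec_)
import Relation.Unary as U

record Graph (n : ℕ) : Set₁ where
  field
    _~_      : Rel (Fin n) 0ℓ
    _~?_     : Decidable _~_
    ~-sym    : Symmetric _~_
    ~-irrefl : Irreflexive _≡_ _~_

module _ {n : ℕ} (G : Graph n) where
  open Graph G

  degree : Fin n → ℕ
  degree u = length (filter (u ~?_) (allFin n))

  Isolated : Fin n → Set
  Isolated u = degree u ≡ 0

  -- As maxima over lists of naturals with default 0, these are 0 when there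
  -- is no vertex to range over.
  Δ : ℕ
  Δ = max 0 (map degree (allFin n))

  Δ-on : Subset n → ℕ
  Δ-on S = max 0 (map degree (filter (_∈? S) (allFin n)))

  record IsBipartition (V₁ V₂ : Subset n) : Set where
    field
      cover    : ∀ v → v ∈ V₁ ⊎ v ∈ V₂
      disjoint : ∀ v → ¬ (v ∈ V₁ × v ∈ V₂)
      crossing : ∀ {u v} → u ~ v → (u ∈ V₁ × v ∈ V₂) ⊎ (u ∈ V₂ × v ∈ V₁)

  -- Each undirected edge is listed exactly once, as the pair of its endpoints
  -- in increasing order; an edge is then a position in this list.
  edges : List (Fin n × Fin n)
  edges = filter (λ (u , v) → (u <? v) ×-dec (u ~? v))
                 (cartesianProduct (allFin n) (allFin n))

  Edge : Set
  Edge = Fin (length edges)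

  Joins : Edge → Fin n → Fin n → Set
  Joins e u v = lookup edges e ≡ (u , v) ⊎ lookup edges e ≡ (v , u)

  FormPath₃ : Edge → Edge → Edge → Set
  FormPath₃ e₁ e₂ e₃ = ∃[ a ] ∃[ b ] ∃[ c ] ∃[ d ]
    Unique (a ∷ b ∷ c ∷ d ∷ []) × Joins e₁ a b × Joins e₂ b c × Joins e₃ c d

  FormCycle₃ : Edge → Edge → Edge → Set
  FormCycle₃ e₁ e₂ e₃ = ∃[ a ] ∃[ b ] ∃[ c ]
    Unique (a ∷ b ∷ c ∷ []) × Joins e₁ a b × Joins e₂ b c × Joins e₃ c a

  Consecutive : Edge → Edge → Edge → Set
  Consecutive e₁ e₂ e₃ = FormPath₃ e₁ e₂ e₃ ⊎ FormCycle₃ e₁ e₂ e₃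

  IsInjectiveColoring : ∀ {k} → (Edge → Fin k) → Set
  IsInjectiveColoring c = ∀ e₁ e₂ e₃ → Consecutive e₁ e₂ e₃ → c e₁ ≢ c e₃

  InjectivelyColorable : ℕ → Set
  InjectivelyColorable k = ∃ λ (c : Edge → Fin k) → IsInjectiveColoring c

  joins? : ∀ e u v → Dec (Joins e u v)
  joins? e u v = (lookup edges e ≟² (u , v)) ⊎-dec (lookup edges e ≟² (v , u))
    where _≟²_ = ≡-dec (_≟_ {n}) (_≟_ {n})

  consecutive? : ∀ e₁ e₂ e₃ → Dec (Consecutive e₁ e₂ e₃)
  consecutive? e₁ e₂ e₃ =
    any? (λ a → any? λ b → any? λ c → any? λ d →
      unique? _ ×-dec joins? e₁ a b ×-dec joins? e₂ b c ×-dec joins? e₃ c d)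
    ⊎-dec
    any? (λ a → any? λ b → any? λ c →
      unique? _ ×-dec joins? e₁ a b ×-dec joins? e₂ b c ×-dec joins? e₃ c a)
    where open DecUnique (_≟_ {n}) using (unique?)

  isInjectiveColoring? : ∀ {k} (c : Edge → Fin k) → Dec (IsInjectiveColoring c)
  isInjectiveColoring? c = all? λ e₁ → all? λ e₂ → all? λ e₃ →
    consecutive? e₁ e₂ e₃ →-dec ¬? (c e₁ ≟ c e₃)

  isInjectiveColoring-resp-≗ : ∀ {k} {c c′ : Edge → Fin k} → c ≗ c′ →
                               IsInjectiveColoring c → IsInjectiveColoring c′
  isInjectiveColoring-resp-≗ c≗c′ inj e₁ e₂ e₃ con eq =
    inj e₁ e₂ e₃ con (trans (c≗c′ e₁) (trans eq (sym (c≗c′ e₃))))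

  injectivelyColorable? : U.Decidable InjectivelyColorable
  injectivelyColorable? k = map′
    (λ (i , inj) → finToFun i , inj)
    (λ (c , inj) → funToFin c ,
       isInjectiveColoring-resp-≗ (sym ∘ finToFun-funToFin c) inj)
    (any? λ i → isInjectiveColoring? (finToFun {k} {length edges} i))

  joins-endpoints : ∀ {e u v x y} → Joins e u v → Joins e x y →
                    (u ≡ x × v ≡ y) ⊎ (u ≡ y × v ≡ x)
  joins-endpoints (inj₁ p) (inj₁ q) with refl ← trans (sym p) q = inj₁ (refl , refl)
  joins-endpoints (inj₁ p) (inj₂ q) with refl ← trans (sym p) q = inj₂ (refl , refl)
  joins-endpoints (inj₂ p) (inj₁ q) with refl ← trans (sym p) q = inj₂ (refl , refl)
  joins-endpoints (inj₂ p) (inj₂ q) with refl ← trans (sym p) q = inj₁ (refl , refl)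

  consecutive⇒≢ : ∀ {e₁ e₂ e₃} → Consecutive e₁ e₂ e₃ → e₁ ≢ e₃
  consecutive⇒≢ {e} (inj₁ (_ , _ , _ , _ , (_ ∷ a≢c ∷ a≢d ∷ []) ∷ _ , ab , _ , cd)) refl =
    [ a≢c ∘ proj₁ , a≢d ∘ proj₁ ]′ (joins-endpoints {e} ab cd)
  consecutive⇒≢ {e} (inj₂ (_ , _ , _ , (_ ∷ a≢c ∷ []) ∷ (b≢c ∷ []) ∷ _ , ab , _ , ca)) refl =
    [ a≢c ∘ proj₁ , b≢c ∘ proj₂ ]′ (joins-endpoints {e} ab ca)

  rainbow : InjectivelyColorable (length edges)
  rainbow = id , λ _ _ _ → consecutive⇒≢

IsLeast : (ℕ → Set) → ℕ → Set
IsLeast P k = P k × (∀ j → P j → k ≤ j)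

least : ∀ {P : ℕ → Set} → U.Decidable P → ∀ n → P n → ∃ (IsLeast P)
least P? zero    p = zero , p , λ _ _ → z≤n
least P? (suc n) p with P? zero
... | yes p₀ = zero , p₀ , λ _ _ → z≤n
... | no ¬p₀ with k , pₖ , min ← least (P? ∘ suc) n p =
  suc k , pₖ , λ where
    zero    p₀ → contradiction p₀ ¬p₀
    (suc j) pⱼ → s≤s (min j pⱼ)

leastColors : ∀ {n} (G : Graph n) → ∃ (IsLeast (InjectivelyColorable G))
leastColors G = least (injectivelyColorable? G) (length (edges G)) (rainbow G)

χ′inj : ∀ {n} → Graph n → ℕ
χ′inj G = proj₁ (leastColors G)

χ′inj-isLeast : ∀ {n} (G : Graph n) → IsLeast (InjectivelyColorable G) (χ′inj G)
χ′inj-isLeast G = proj₂ (leastColors G)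

{-# OPTIONS --safe #-}

-- Give each edge a colour depending only on its endpoint on one fixed side S.
-- On a path of three edges, the S-endpoints of the two outer edges are distinct
-- with a common neighbour, so it suffices to colour S such that any two distinct
-- vertices with a common neighbour get different colours.  A vertex of S has at
-- most Δ_S (Δ_T − 1) other vertices at distance two, so greedy colouring needs
-- at most Δ_S (Δ_T − 1) + 1 colours.  If Δ = 2 this is at most 3.

module Submission where

open import Defs
open import Data.Fin using (Fin; zero)
open import Data.Fin.Properties using (_≟_; any?; injective⇒≤)
open import Data.Fin.Subset using (Subset) renaming (_∈_ to _∈ₛ_; _∉_ to _∉ₛ_)
open import Data.Fin.Subset.Properties using () renaming (_∈?_ to _∈ₛ?_)
open import Data.List using (List; []; _∷_; length; map; filter; allFin; cartesianProduct; concatMap; lookup)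
open import Data.List.Extrema.Nat using (xs≤max; max-mono-⊆)
open import Data.List.Membership.DecPropositional using () renaming (_∈?_ to member?)
open import Data.List.Membership.Propositional using (_∈_; _∉_)
open import Data.List.Membership.Propositional.Properties
  using (∈-map⁺; ∈-filter⁺; ∈-filter⁻; ∈-allFin; ∈-lookup; ∈-concatMap⁺)
open import Data.List.Membership.Setoid.Properties using (index-injective)
open import Data.List.Properties using (length-++; length-map; filter-notAll)
import Data.List.Relation.Binary.Subset.Propositional.Properties as Subset
open import Data.List.Relation.Unary.All as All using (_∷_)
open import Data.List.Relation.Unary.AllPairs using (_∷_)
open import Data.List.Relation.Unary.Any as Any using (here; there; index)
open import Data.Nat using (ℕ; suc; _+_; _*_; _∸_; _⊓_; _≤_; z≤n; s≤s)
open import Data.Nat.Properties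
  using (≤-refl; ≤-reflexive; ≤-trans; 1+n≰n; +-comm; +-mono-≤; *-mono-≤; *-monoˡ-≤;
         ∸-monoˡ-≤; ⊓-glb)
open import Data.Product using (∃; _×_; _,_; proj₁; proj₂)
open import Data.Sum using (inj₁; inj₂; swap)
open import Function using (_∘_)
open import Level using (Level)
open import Relation.Binary using (Rel; Symmetric; DecidableEquality)
open import Relation.Binary.PropositionalEquality
  using (_≡_; _≢_; refl; sym; subst; setoid)
open import Relation.Nullary using (¬_; yes; no; contradiction)
open import Relation.Nullary.Decidable using (¬?; decidable-stable)

private variable
  a r : Level
  A B : Set a

length-concatMap-≤ : ∀ (f : A → List B) {b} xs → (∀ {x} → x ∈ xs → length (f x) ≤ b) →
                     length (concatMap f xs) ≤ length xs * b
length-concatMap-≤ f []       bound = z≤n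
length-concatMap-≤ f (x ∷ xs) bound = ≤-trans
  (≤-reflexive (length-++ (f x)))
  (+-mono-≤ (bound (here refl)) (length-concatMap-≤ f xs (bound ∘ there)))

-- Pigeonhole: if every colour occurred in `cs`, sending each to its position would inject
-- `Fin (suc D)` into `Fin (length cs)`.
∃-fresh : ∀ {D} (cs : List (Fin (suc D))) → length cs ≤ D → ∃ (_∉ cs)
∃-fresh cs ∣cs∣≤D with any? (λ c → ¬? (member? _≟_ c cs))
... | yes fresh = fresh
... | no ¬fresh = contradiction (≤-trans (injective⇒≤ index-inj) ∣cs∣≤D) 1+n≰n
  where
  all∈ : ∀ c → c ∈ cs
  all∈ c = decidable-stable (member? _≟_ c cs) λ c∉cs → ¬fresh (c , c∉cs)
  index-inj : ∀ {c d} → index (all∈ c) ≡ index (all∈ d) → c ≡ d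
  index-inj {c} {d} = index-injective (setoid _) (all∈ c) (all∈ d)

module _ (_≟ᴬ_ : DecidableEquality A) {R : Rel A r} (R-sym : Symmetric R)
         (N : A → List A) (R⇒∈N : ∀ {x y} → R x y → y ∈ N x) where

  -- Induction on the list: the tail is coloured first, then the colouring is overridden at the head
  -- `v` by a colour that avoids the at most `D` values of `f` on `N v`.
  greedy : ∀ {D} xs → (∀ {x} → x ∈ xs → length (N x) ≤ D) →
           ∃ λ (f : A → Fin (suc D)) →
             ∀ {x y} → x ∈ xs → y ∈ xs → x ≢ y → R x y → f x ≢ f y
  greedy []       bound = (λ _ → zero) , λ ()
  greedy {D} (v ∷ vs) bound
    with f , f-ok ← greedy vs (bound ∘ there)
    with c , c∉ ← ∃-fresh (map f (N v))
                    (subst (_≤ D) (sym (length-map f (N v))) (bound (here refl)))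
    = g , g-ok
    where
    g : A → Fin (suc D)
    g x with x ≟ᴬ v
    ... | yes _ = c
    ... | no  _ = f x

    c≢ : ∀ {y} → R v y → c ≢ f y
    c≢ vRy c≡fy = c∉ (subst (_∈ map f (N v)) (sym c≡fy) (∈-map⁺ f (R⇒∈N vRy)))

    g-ok : ∀ {x y} → x ∈ v ∷ vs → y ∈ v ∷ vs → x ≢ y → R x y → g x ≢ g y
    g-ok {x} {y} x∈ y∈ x≢y xRy with x ≟ᴬ v | y ≟ᴬ v
    ... | yes refl | yes refl = contradiction refl x≢y
    ... | yes refl | no  _    = c≢ xRy
    ... | no  _    | yes refl = c≢ (R-sym xRy) ∘ sym
    ... | no  x≢v  | no  y≢v  = f-ok (Any.tail x≢v x∈) (Any.tail y≢v y∈) x≢y xRy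

module _ {n : ℕ} (G : Graph n) where
  open Graph G

  neighbours : Fin n → List (Fin n)
  neighbours u = filter (u ~?_) (allFin n)

  ∈-neighbours⁺ : ∀ {u v} → u ~ v → v ∈ neighbours u
  ∈-neighbours⁺ {u} {v} = ∈-filter⁺ (u ~?_) (∈-allFin v)

  ∈-neighbours⁻ : ∀ {u v} → v ∈ neighbours u → u ~ v
  ∈-neighbours⁻ {u} = proj₂ ∘ ∈-filter⁻ (u ~?_) {xs = allFin n}

  Joins⇒~ : ∀ e {u v} → Joins G e u v → u ~ v
  Joins⇒~ e = λ where
      (inj₁ eq) → subst (λ (x , y) → x ~ y) eq adjacent
      (inj₂ eq) → ~-sym (subst (λ (x , y) → x ~ y) eq adjacent)
    where
    adjacent : proj₁ (lookup (edges G) e) ~ proj₂ (lookup (edges G) e)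
    adjacent = proj₂ (proj₂ (∈-filter⁻ _ {xs = cartesianProduct (allFin n) (allFin n)}
                                         (∈-lookup {xs = edges G} e)))

  degree≤Δ-on : ∀ S {u} → u ∈ₛ S → degree G u ≤ Δ-on G S
  degree≤Δ-on S {u} u∈S = All.lookup (xs≤max 0 _)
    (∈-map⁺ (degree G) (∈-filter⁺ (_∈ₛ? S) (∈-allFin u) u∈S))

  Δ-on≤Δ : ∀ S → Δ-on G S ≤ Δ G
  Δ-on≤Δ S = max-mono-⊆ ≤-refl (Subset.map⁺ (degree G) (Subset.filter-⊆ (_∈ₛ? S) (allFin n)))

  -- The clause `x ≢ y` keeps `x` out of its own second neighbourhood; this is what yields the
  -- factor `Δ-on G T ∸ 1` instead of `Δ-on G T`.
  CommonNeighbour : Rel (Fin n) _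
  CommonNeighbour x y = x ≢ y × ∃ λ z → x ~ z × z ~ y

  CommonNeighbour-sym : Symmetric CommonNeighbour
  CommonNeighbour-sym (x≢y , z , x~z , z~y) = x≢y ∘ sym , z , ~-sym z~y , ~-sym x~z

  otherNeighbours : Fin n → Fin n → List (Fin n)
  otherNeighbours x z = filter (λ y → ¬? (x ≟ y)) (neighbours z)

  -- A vertex is listed once for each neighbour it shares with `x`; the repetitions are harmless,
  -- since only an upper bound on the length is wanted.
  secondNeighbours : Fin n → List (Fin n)
  secondNeighbours x = concatMap (otherNeighbours x) (neighbours x)

  ∈-secondNeighbours : ∀ {x y} → CommonNeighbour x y → y ∈ secondNeighbours x
  ∈-secondNeighbours {x} {y} (x≢y , z , x~z , z~y) =
    ∈-concatMap⁺ (otherNeighbours x) (Any.map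
      (λ { refl → ∈-filter⁺ (λ y → ¬? (x ≟ y)) (∈-neighbours⁺ z~y) x≢y })
      (∈-neighbours⁺ x~z))

  length-otherNeighbours : ∀ {x z} → x ~ z → length (otherNeighbours x z) ≤ degree G z ∸ 1
  -- As `x` is itself a neighbour of `z`, the filter drops at least one entry, so the length is
  -- strictly below the degree.
  length-otherNeighbours {x} {z} x~z = ∸-monoˡ-≤ 1
    (filter-notAll (λ y → ¬? (x ≟ y)) (neighbours z)
      (Any.map (λ x≡y x≢y → x≢y x≡y) (∈-neighbours⁺ (~-sym x~z))))

  IsBipartition-sym : ∀ {S T} → IsBipartition G S T → IsBipartition G T S
  IsBipartition-sym bip = record
    { cover    = swap ∘ cover
    ; disjoint = λ v (v∈T , v∈S) → disjoint v (v∈S , v∈T)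
    ; crossing = swap ∘ crossing
    }
    where
    open IsBipartition bip

  neighbour-∈ : ∀ {S T} → IsBipartition G S T → ∀ {x z} → x ∈ₛ S → x ~ z → z ∈ₛ T
  neighbour-∈ bip {x} x∈S x~z with IsBipartition.crossing bip x~z
  ... | inj₁ (_ , z∈T) = z∈T
  ... | inj₂ (x∈T , _) = contradiction (x∈S , x∈T) (IsBipartition.disjoint bip x)

  -- Sides alternate along edges, so three steps from `x` and back would put `x` in `T` as well.
  triangle-free : ∀ {S T} → IsBipartition G S T → ∀ {x y z} → x ∈ₛ S → x ~ y → y ~ z → ¬ (z ~ x)
  triangle-free bip {x} x∈S x~y y~z z~x = IsBipartition.disjoint bip x
    (x∈S , neighbour-∈ bip (neighbour-∈ (IsBipartition-sym bip) (neighbour-∈ bip x∈S x~y) y~z) z~x)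

  module _ {S T : Subset n} (bip : IsBipartition G S T) where
    open IsBipartition bip

    length-secondNeighbours : ∀ {x} → x ∈ₛ S →
      length (secondNeighbours x) ≤ Δ-on G S * (Δ-on G T ∸ 1)
    length-secondNeighbours {x} x∈S = ≤-trans
      (length-concatMap-≤ (otherNeighbours x) (neighbours x) λ z∈ →
        let x~z = ∈-neighbours⁻ z∈ in
        ≤-trans (length-otherNeighbours x~z)
                (∸-monoˡ-≤ 1 (degree≤Δ-on T (neighbour-∈ bip x∈S x~z))))
      (*-monoˡ-≤ (Δ-on G T ∸ 1) (degree≤Δ-on S x∈S))

    -- The endpoint in `S`. An edge stores its ends in increasing order, regardless of side, so
    -- membership has to be tested.
    endpoint : Edge G → Fin n
    endpoint e with (u , v) ← lookup (edges G) e with u ∈ₛ? S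
    ... | yes _ = u
    ... | no  _ = v

    endpoint-joins : ∀ e {u v} → Joins G e u v → u ∈ₛ S → v ∉ₛ S → endpoint e ≡ u
    endpoint-joins e {u} {v} (inj₁ eq) u∈S v∉S rewrite eq with u ∈ₛ? S
    ... | yes _   = refl
    ... | no  u∉S = contradiction u∈S u∉S
    endpoint-joins e {u} {v} (inj₂ eq) u∈S v∉S rewrite eq with v ∈ₛ? S
    ... | yes v∈S = contradiction v∈S v∉S
    ... | no  _   = refl

    colorable : InjectivelyColorable G (suc (Δ-on G S * (Δ-on G T ∸ 1)))
    colorable
      with f , f-ok ← greedy _≟_ CommonNeighbour-sym secondNeighbours ∈-secondNeighbours
             (filter (_∈ₛ? S) (allFin n))
             (length-secondNeighbours ∘ proj₂ ∘ ∈-filter⁻ (_∈ₛ? S) {xs = allFin n})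
      = f ∘ endpoint , f-inj
      where
      ∉S : ∀ {v} → v ∈ₛ T → v ∉ₛ S
      ∉S {v} v∈T v∈S = disjoint v (v∈S , v∈T)

      -- Serves both orientations of a path: `x` and `y` are the `S`-endpoints of its outer edges,
      -- and `z` is the inner vertex lying in `T`.
      separated : ∀ {x y z e e′ x′ y′} → x ≢ y → x ~ z → z ~ y →
                  Joins G e x x′ → Joins G e′ y y′ →
                  x ∈ₛ S → y ∈ₛ S → f (endpoint e) ≢ f (endpoint e′)
      separated {x} {y} {z} {e} {e′} x≢y x~z z~y ex e′y x∈S y∈S
        rewrite endpoint-joins e ex x∈S (∉S (neighbour-∈ bip x∈S (Joins⇒~ e ex)))
              | endpoint-joins e′ e′y y∈S (∉S (neighbour-∈ bip y∈S (Joins⇒~ e′ e′y)))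
        = f-ok (∈-filter⁺ (_∈ₛ? S) (∈-allFin x) x∈S) (∈-filter⁺ (_∈ₛ? S) (∈-allFin y) y∈S)
               x≢y (x≢y , z , x~z , z~y)

      f-inj : IsInjectiveColoring G (f ∘ endpoint)
      f-inj e₁ e₂ e₃ (inj₁ (a , b , c , d , (_ ∷ a≢c ∷ _) ∷ (_ ∷ b≢d ∷ _) ∷ _ , ab , bc , cd))
        with a~b ← Joins⇒~ e₁ ab | b~c ← Joins⇒~ e₂ bc | c~d ← Joins⇒~ e₃ cd
        -- The side of `b` decides which ends lie in `S`: either `b` and `d`, with common neighbour
        -- `c`, or `a` and `c`, with common neighbour `b`.
        with crossing b~c
      ... | inj₁ (b∈S , c∈T) =
        separated {e = e₁} {e₃} b≢d b~c c~d (swap ab) (swap cd)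
          b∈S (neighbour-∈ (IsBipartition-sym bip) c∈T c~d)
      ... | inj₂ (b∈T , c∈S) =
        separated {e = e₁} {e₃} a≢c a~b b~c ab cd
          (neighbour-∈ (IsBipartition-sym bip) b∈T (~-sym a~b)) c∈S
      -- A triangle cannot occur, whichever side `a` is on.
      f-inj e₁ e₂ e₃ (inj₂ (a , b , c , _ , ab , bc , ca)) _
        with crossing (Joins⇒~ e₁ ab)
      ... | inj₁ (a∈S , _) =
        triangle-free bip a∈S (Joins⇒~ e₁ ab) (Joins⇒~ e₂ bc) (Joins⇒~ e₃ ca)
      ... | inj₂ (a∈T , _) =
        triangle-free (IsBipartition-sym bip) a∈T (Joins⇒~ e₁ ab) (Joins⇒~ e₂ bc) (Joins⇒~ e₃ ca)

    χ′inj-≤ : χ′inj G ≤ suc (Δ-on G S * (Δ-on G T ∸ 1))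
    χ′inj-≤ = proj₂ (χ′inj-isLeast G) _ colorable

proposition1p12 : ∀ {n : ℕ} (G : Graph n) (V₁ V₂ : Subset n) →
    IsBipartition G V₁ V₂ →
    (∀ v → ¬ Isolated G v) →
    (3 ≤ Δ G → χ′inj G ≤ ((Δ-on G V₁ * (Δ-on G V₂ ∸ 1)) ⊓ (Δ-on G V₂ * (Δ-on G V₁ ∸ 1))) + 1)
    × (Δ G ≡ 2 → χ′inj G ≤ 3)
proposition1p12 G V₁ V₂ bip _ = (λ _ → bound) , λ Δ≡2 → ≤-trans (χ′inj-≤ G bip)
    -- The bound 3 arises as `suc (2 * (2 ∸ 1))`.
    (s≤s (*-mono-≤ (≤2 Δ≡2 V₁) (∸-monoˡ-≤ 1 (≤2 Δ≡2 V₂))))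
  where
  ≤2 : Δ G ≡ 2 → ∀ S → Δ-on G S ≤ 2
  ≤2 Δ≡2 S = subst (Δ-on G S ≤_) Δ≡2 (Δ-on≤Δ G S)

  bound : χ′inj G ≤ ((Δ-on G V₁ * (Δ-on G V₂ ∸ 1)) ⊓ (Δ-on G V₂ * (Δ-on G V₁ ∸ 1))) + 1
  bound rewrite +-comm ((Δ-on G V₁ * (Δ-on G V₂ ∸ 1)) ⊓ (Δ-on G V₂ * (Δ-on G V₁ ∸ 1))) 1 =
    -- Each term of the minimum comes from colouring by the endpoints on one of the two sides; `suc`
    -- passes through `⊓` by computation.
    ⊓-glb (χ′inj-≤ G bip) (χ′inj-≤ G (IsBipartition-sym G bip))
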